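{- Let $\mathbb{F}$ be a field with $|\mathbb{F}| \ge n^2$. For every large enough $n$, there exists a non-zero polynomial $Q \in \mathbb{F}[x_{1,1}, \ldots, x_{n,n}]$ of degree at most $n^3$ such that $Q(A) = 0$ for every matrix $A \in \mathbb{F}^{n\times n}$ whose corresponding linear transformation can be computed by a linear circuit of size at most $n^2/200$.
   Context: A linear circuit over $\mathbb{F}$ is a directed acyclic graph with $n$ input nodes labeled $X_1, \ldots, X_n$ and $n$ designated output nodes, in which every edge is labeled by a scalar in $\mathbb{F}$. Each input node $X_i$ computes the linear form $X_i$; an internal node $u$ whose children $v_1, \ldots, v_k$ are connected to it by edges labeled $\alpha_1, \ldots, \alpha_k$ computes $\sum_i \alpha_i \ell_{v_i}$, where $\ell_{v_i}$ is the linear form computed by $v_i$. The circuit computes the linear transformation whose $j$-th output coordinate is the linear form computed at the $j$-th output node; a matrix $A$ is computed by the circuit if this linear transformation is $X \mapsto AX$ (equivalently, the matrix formed by the coefficients of the output linear forms). The size of the circuit is its number of edges. $Q(A)$ means $Q$ evaluated at $x_{i,j} = a_{i,j}$. -}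

module Defs where

open import Level using (Level; _⊔_)
open import Algebra.Bundles using (CommutativeRing)
open import Data.Nat as ℕ using (ℕ; zero; suc; _≤_)
open import Data.Fin as Fin using (Fin)
open import Data.Vec as Vec using (Vec; []; _∷_; _∷ʳ_; lookup; tabulate)
open import Data.Vec.Properties using (≡-dec)
open import Data.List as List using (List; []; _∷_; length)
open import Data.List.Membership.Propositional using (_∈_)
open import Data.Bool using (if_then_else_)
open import Data.Product using (Σ; ∃; _×_; _,_)
open import Relation.Nullary using (¬_; yes; no)
open import Relation.Binary.PropositionalEquality using (_≡_)

record Field (c ℓ : Level) : Set (Level.suc (c ⊔ ℓ)) where
  field
    commutativeRing : CommutativeRing c ℓ
  open CommutativeRing commutativeRing public
  field
    0≉1     : ¬ (0# ≈ 1#)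
    inverse : ∀ x → ¬ (x ≈ 0#) → ∃ λ y → x * y ≈ 1#

module _ {c ℓ : Level} (F : Field c ℓ) where
  open Field F renaming (_*_ to _·_; _+_ to _⊕_)

  CardAtLeast : ℕ → Set (c ⊔ ℓ)
  CardAtLeast m = Σ (Fin m → Carrier) λ f → ∀ i j → f i ≈ f j → i ≡ j

  Matrix : ℕ → Set c
  Matrix n = Fin n → Fin n → Carrier

  -- Polynomials in the n² variables x_{i,j}, given as finite lists of
  -- terms (coefficient, exponent matrix e), the term meaning
  -- c · ∏_{i,j} x_{i,j}^{e i j}.

  Exponent : ℕ → Set
  Exponent n = Vec (Vec ℕ n) n

  Poly : ℕ → Set c
  Poly n = List (Carrier × Exponent n)

  sumℕ : ∀ {k} → Vec ℕ k → ℕ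
  sumℕ = Vec.foldr _ ℕ._+_ 0

  monoDeg : ∀ {n} → Exponent n → ℕ
  monoDeg e = sumℕ (Vec.map sumℕ e)

  DegreeAtMost : ∀ {n} → Poly n → ℕ → Set c
  DegreeAtMost {n} Q d = ∀ {a e} → (a , e) ∈ Q → monoDeg e ≤ d

  coeff : ∀ {n} → Poly n → Exponent n → Carrier
  coeff [] e = 0#
  coeff ((a , e′) ∷ Q) e with ≡-dec (≡-dec ℕ._≟_) e′ e
  ... | yes _ = a ⊕ coeff Q e
  ... | no  _ = coeff Q e

  NonZero : ∀ {n} → Poly n → Set ℓ
  NonZero Q = ∃ λ e → ¬ (coeff Q e ≈ 0#)

  pow : Carrier → ℕ → Carrier
  pow x zero    = 1#
  pow x (suc k) = x · pow x k

  prodF : ∀ {k} → Vec Carrier k → Carrier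
  prodF = Vec.foldr _ _·_ 1#

  evalMono : ∀ {n} → Exponent n → Matrix n → Carrier
  evalMono e A =
    prodF (tabulate λ i → prodF (tabulate λ j → pow (A i j) (lookup (lookup e i) j)))

  eval : ∀ {n} → Poly n → Matrix n → Carrier
  eval [] A = 0#
  eval ((a , e) ∷ Q) A = (a · evalMono e A) ⊕ eval Q A

  -- Linear circuits with n inputs.  Nodes are numbered in a topological
  -- order: nodes 0 … n-1 are the inputs X_1 … X_n, and every further node
  -- lists its incoming edges as (child, label) with child an earlier node.
  -- Gates n N : a circuit body with N nodes in total.

  data Gates (n : ℕ) : ℕ → Set c where
    inputs : Gates n n
    _▹_    : ∀ {N} → Gates n N → List (Fin N × Carrier) → Gates n (suc N)

  LinForm : ℕ → Set c
  LinForm n = Vec Carrier n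

  zeroForm : ∀ {n} → LinForm n
  zeroForm = Vec.replicate _ 0#

  unitForm : ∀ {n} → Fin n → LinForm n
  unitForm i = tabulate λ j → if Fin.toℕ i ℕ.≡ᵇ Fin.toℕ j then 1# else 0#

  forms : ∀ {n N} → Gates n N → Vec (LinForm n) N
  forms inputs  = tabulate unitForm
  forms (g ▹ es) = fs ∷ʳ List.foldr step zeroForm es
    where
      fs = forms g
      step : _ → LinForm _ → LinForm _
      step (v , α) acc = Vec.zipWith _⊕_ (Vec.map (α ·_) (lookup fs v)) acc

  gatesSize : ∀ {n N} → Gates n N → ℕ
  gatesSize inputs   = 0
  gatesSize (g ▹ es) = gatesSize g ℕ.+ length es

  record Circuit (n : ℕ) : Set c where
    field
      nodes   : ℕ
      gates   : Gates n nodes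
      outputs : Vec (Fin nodes) n

  size : ∀ {n} → Circuit n → ℕ
  size C = gatesSize (Circuit.gates C)

  Computes : ∀ {n} → Circuit n → Matrix n → Set ℓ
  Computes C A = ∀ j k →
    lookup (lookup (forms (Circuit.gates C)) (lookup (Circuit.outputs C) j)) k ≈ A j k

{-# OPTIONS --safe #-}
module Submission where

-- Split every gate of a circuit into binary operations u + α v, one per edge.  The
-- circuits of size at most s = n² / 200 then arise from at most n^O(s+n) skeletons
-- by assigning values to s labels, and the output matrix is given by
-- polynomials in the labels with natural coefficients.  Let Q range over the
-- subset sums of the n^(n²) monomials with all exponents below n.  All the
-- coefficients of the substitutions of all the skeletons into Q, taken together, are
-- fewer than n^(n²) / n⁶ numbers of at most n⁶ bits, so by the pigeonhole principle
-- two distinct subset sums agree on every small circuit.  Their difference has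
-- a coefficient ±1, hence is nonzero in any field; in particular no linear
-- algebra, which would require a decidable equality on the field, is used.

open import Defs
open import Level using (Level; _⊔_)
open import Data.Nat using (ℕ; zero; suc; _≤_; _*_; _^_; _+_; _<_; z≤n; s≤s; z<s; _≤′_; ≤′-reflexive; ≤′-step; _/_; _≡ᵇ_; >-nonZero) renaming (NonZero to ℕ-NonZero)
open import Data.Nat.Properties hiding (<⇒≢; suc-injective)
open import Data.Nat.Tactic.RingSolver using (solve-∀)
open import Data.Nat.DivMod using (m/n*n≤m; /-monoˡ-≤; m*n/n≡m)
open import Data.Bool using (true; false; if_then_else_)
open import Data.Fin as Fin using (Fin; zero; suc; toℕ; fromℕ<; _↑ʳ_; finToFun; funToFin)
open import Data.Fin.Properties using (toℕ-fromℕ<; toℕ<n; toℕ-injective; suc-injective; pigeonhole; ¬∀⟶∃¬; *↔×; funToFin-finToFin; finToFun-funToFin; <⇒≢)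
open import Data.Vec as Vec using (Vec; []; _∷_; _∷ʳ_; lookup; tabulate)
open import Data.Vec.Properties using (≡-dec; tabulate-cong; tabulate∘lookup; lookup∘tabulate; lookup-map; lookup-zipWith; lookup-replicate; tabulate-∘)
open import Data.Vec.Relation.Unary.All as VAll using ([]; _∷_)
open import Data.Vec.Relation.Binary.Pointwise.Inductive as Pointwise using (Pointwise; []; _∷_)
open import Data.List as List using (List; []; _∷_; [_]; _++_; length; filter; concat; cartesianProductWith)
open import Data.List.Properties using (length-map; length-++; length-filter; filter-++; filter-accept)
open import Data.List.Relation.Unary.All as All using (All; []; _∷_)
open import Data.List.Relation.Unary.All.Properties using (++⁺; ++⁻; map⁺; cartesianProductWith⁺)
open import Data.List.Relation.Unary.Any using (here; there)
open import Data.List.Membership.Propositional using (_∈_)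
open import Data.List.Membership.Propositional.Properties using (∈-∃++; ∈-tabulate⁻)
open import Data.List.Relation.Binary.Permutation.Propositional using (_↭_; prep; swap; ↭-refl; ↭-sym; ↭-trans) renaming (refl to ↭-refl′; trans to ↭-trans′)
open import Data.List.Relation.Binary.Permutation.Propositional.Properties using (shift)
open import Data.Product using (Σ; ∃; ∃₂; _×_; _,_; proj₂)
open import Data.Product.Function.NonDependent.Propositional using (_×-↪_)
open import Data.Unit using (⊤; tt)
open import Function using (_∘_; _↪_; mk↪)
open import Function.Bundles using (module RightInverse)
open import Function.Construct.Composition using (_↪-∘_)
open import Function.Construct.Identity using (↪-id)
open import Function.Construct.Symmetry using (↔-sym)
open import Function.Properties.Inverse using (↔⇒↪)
open import Relation.Nullary using (¬_; yes; no; contradiction)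
open import Relation.Binary.PropositionalEquality as ≡ using (_≡_; _≢_; _≗_; refl; sym; trans; cong; cong₂; subst)
import Relation.Binary.Reasoning.Setoid as SetoidReasoning

private
  variable
    a : Level
    A : Set a
    d e i k l m n s : ℕ

-- Finite types

funToFin-cong : {f g : Fin m → Fin n} → f ≗ g → funToFin f ≡ funToFin g
funToFin-cong {zero}  f≗g = refl
funToFin-cong {suc m} f≗g = cong₂ Fin.combine (f≗g zero) (funToFin-cong (f≗g ∘ suc))

finToFun-injective : ∀ m {i j : Fin (n ^ m)} → finToFun {n} {m} i ≗ finToFun j → i ≡ j
finToFun-injective {n} m {i} {j} eq = begin
  i                             ≡⟨ funToFin-finToFin {m} {n} i ⟨
  funToFin (finToFun {n} {m} i) ≡⟨ funToFin-cong eq ⟩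
  funToFin (finToFun {n} {m} j) ≡⟨ funToFin-finToFin {m} {n} j ⟩
  j                             ∎
  where open ≡.≡-Reasoning

×-↪-Fin : {B C : Set} → B ↪ Fin k → C ↪ Fin l → (B × C) ↪ Fin (k * l)
×-↪-Fin B↪ C↪ = ↔⇒↪ (↔-sym *↔×) ↪-∘ (B↪ ×-↪ C↪)

-- Vectors instead of functions, so that decoding an encoding is a propositional equality without
-- function extensionality.
Vec-Fin-↪-Fin : ∀ k n → Vec (Fin k) n ↪ Fin (k ^ n)
Vec-Fin-↪-Fin k n = mk↪ {to = funToFin ∘ lookup} {from = tabulate ∘ finToFun} λ {v} → λ where
  refl → trans (tabulate-cong (finToFun-funToFin (lookup v))) (tabulate∘lookup v)

-- A form of Siegel's lemma: the difference b - b′ is a solution with entries in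
-- {-1, 0, 1}, so it stays nonzero in every nontrivial ring.
siegel : {Cell : Set} {E M K : ℕ} → Cell ↪ Fin E → K ^ E < 2 ^ M →
         (f : (Fin M → Fin 2) → Cell → ℕ) → (∀ b c → f b c < K) →
         ∃₂ λ b b′ → (∃ λ i → b i ≢ b′ i) × (∀ c → f b c ≡ f b′ c)
siegel {Cell} {E} {M} {K} enum K^E<2^M f f<K =
  let i , j , i<j , eq = pigeonhole K^E<2^M (λ x → funToFin (values (finToFun x)))
      b  = finToFun {2} {M} i
      b′ = finToFun {2} {M} j
  in b , b′
   -- Distinct codes decode to bit strings that are not pointwise equal; with finitely many
   -- decidable positions this yields an explicit position of disagreement.
   , ¬∀⟶∃¬ M _ (λ x → b x Fin.≟ b′ x) (λ b≗b′ → <⇒≢ i<j (finToFun-injective M b≗b′))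
   , λ c → begin
       f b c                       ≡⟨ cong (f b) (strictlyInverseʳ c) ⟨
       f b (from (to c))           ≡⟨ toℕ-fromℕ< (f<K b _) ⟨
       toℕ (values b (to c))       ≡⟨ cong toℕ (values-≗ b b′ eq (to c)) ⟩
       toℕ (values b′ (to c))      ≡⟨ toℕ-fromℕ< (f<K b′ _) ⟩
       f b′ (from (to c))          ≡⟨ cong (f b′) (strictlyInverseʳ c) ⟩
       f b′ c                      ∎
  where
  open RightInverse enum using (to; from; strictlyInverseʳ)
  open ≡.≡-Reasoning
  values : (Fin M → Fin 2) → Fin E → Fin K
  values b x = fromℕ< (f<K b (from x))
  values-≗ : ∀ b b′ → funToFin (values b) ≡ funToFin (values b′) → values b ≗ values b′
  values-≗ b b′ eq x = trans (sym (finToFun-funToFin (values b) x))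
    (trans (cong (λ z → finToFun z x) eq) (finToFun-funToFin (values b′) x))

-- Polynomials with natural coefficients

-- A polynomial in s variables is the list of its monomials, a coefficient
-- being the multiplicity of a monomial.
Monomial : ℕ → Set
Monomial = Vec ℕ

ℕPoly : ℕ → Set
ℕPoly s = List (Monomial s)

one : ℕPoly s
one = [ Vec.replicate _ 0 ]

infixl 7 _⊗_
_⊗_ : ℕPoly s → ℕPoly s → ℕPoly s
_⊗_ = cartesianProductWith (Vec.zipWith _+_)

_⊗^_ : ℕPoly s → ℕ → ℕPoly s
p ⊗^ zero  = one
p ⊗^ suc k = p ⊗ (p ⊗^ k)

∏ : Vec (ℕPoly s) k → ℕPoly s
∏ = Vec.foldr _ _⊗_ one

monomialPoly : Vec (Vec ℕ n) n → (Fin n → Fin n → ℕPoly s) → ℕPoly s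
monomialPoly e X = ∏ (tabulate λ i → ∏ (tabulate λ j → X i j ⊗^ lookup (lookup e i) j))

-- Bits live in `Fin 2` so that `finToFun` decodes elements of `Fin (2 ^ M)` into selections.
choose : Fin 2 → List A → List A
choose zero    xs = []
choose (suc _) xs = xs

subsetSum : (Fin m → Fin 2) → (Fin m → ℕPoly s) → ℕPoly s
subsetSum b p = concat (List.tabulate λ i → choose (b i) (p i))

multiplicity : Monomial s → ℕPoly s → ℕ
multiplicity μ p = length (filter (≡-dec _≟_ μ) p)

multiplicity-accept : (μ : Monomial s) (p : ℕPoly s) → multiplicity μ (μ ∷ p) ≡ suc (multiplicity μ p)
multiplicity-accept μ p = cong length (filter-accept (≡-dec _≟_ μ) refl)

multiplicity-++ : (μ : Monomial s) (p q : ℕPoly s) →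
                  multiplicity μ (p ++ q) ≡ multiplicity μ p + multiplicity μ q
multiplicity-++ μ p q = trans (cong length (filter-++ (≡-dec _≟_ μ) p q)) (length-++ (filter (≡-dec _≟_ μ) p))

multiplicity>0⇒∈ : (μ : Monomial s) (p : ℕPoly s) → 0 < multiplicity μ p → μ ∈ p
multiplicity>0⇒∈ μ (ν ∷ p) 0<c with ≡-dec _≟_ μ ν
... | yes μ≡ν = here μ≡ν
... | no  μ≢ν = there (multiplicity>0⇒∈ μ p 0<c)

multiplicity-shift : (μ ν : Monomial s) (p q : ℕPoly s) →
                     multiplicity μ (p ++ ν ∷ q) ≡ multiplicity μ (ν ∷ p ++ q)
multiplicity-shift μ ν p q = begin
  multiplicity μ (p ++ ν ∷ q)                        ≡⟨ multiplicity-++ μ p (ν ∷ q) ⟩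
  multiplicity μ p + multiplicity μ (ν ∷ q)          ≡⟨ cong (multiplicity μ p +_) (multiplicity-++ μ [ ν ] q) ⟩
  multiplicity μ p + (multiplicity μ [ ν ] + multiplicity μ q) ≡⟨ x∙yz≈y∙xz (multiplicity μ p) (multiplicity μ [ ν ]) (multiplicity μ q) ⟩
  multiplicity μ [ ν ] + (multiplicity μ p + multiplicity μ q) ≡⟨ cong (multiplicity μ [ ν ] +_) (multiplicity-++ μ p q) ⟨
  multiplicity μ [ ν ] + multiplicity μ (p ++ q)     ≡⟨ multiplicity-++ μ [ ν ] (p ++ q) ⟨
  multiplicity μ (ν ∷ p ++ q)                        ∎
  where
  open ≡.≡-Reasoning
  open import Algebra.Properties.CommutativeSemigroup +-commutativeSemigroup using (x∙yz≈y∙xz)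

-- The head of `p` has a positive count in `q`, hence occurs there; removing one copy from both
-- sides preserves the agreement. The predicate `P` confines the comparison to monomials that can
-- occur, so that finitely many counts can suffice.
multiplicity-≡⇒↭ : {P : Monomial s → Set} (p q : ℕPoly s) → All P p → All P q →
                   (∀ μ → P μ → multiplicity μ p ≡ multiplicity μ q) → p ↭ q
multiplicity-≡⇒↭ []      []      _  _ _ = ↭-refl
multiplicity-≡⇒↭ []      (ν ∷ q) _  (Pν ∷ _) eq =
  contradiction (trans (eq ν Pν) (multiplicity-accept ν q)) λ ()
multiplicity-≡⇒↭ (μ ∷ p) q (Pμ ∷ Pp) Pq eq
  with q₁ , q₂ , refl ← ∈-∃++ (multiplicity>0⇒∈ μ q
         (subst (0 <_) (trans (sym (multiplicity-accept μ p)) (eq μ Pμ)) z<s))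
  = ↭-trans (prep μ (multiplicity-≡⇒↭ p (q₁ ++ q₂) Pp Pq₁₂ eq′)) (↭-sym (shift μ q₁ q₂))
  where
  Pq₁₂ : All _ (q₁ ++ q₂)
  Pq₁₂ with Pq₁ , _ ∷ Pq₂ ← ++⁻ q₁ Pq = ++⁺ Pq₁ Pq₂
  eq′ : ∀ ν → _ → multiplicity ν p ≡ multiplicity ν (q₁ ++ q₂)
  eq′ ν Pν = +-cancelˡ-≡ (multiplicity ν [ μ ]) _ _ (begin
    multiplicity ν [ μ ] + multiplicity ν p           ≡⟨ multiplicity-++ ν [ μ ] p ⟨
    multiplicity ν (μ ∷ p)                            ≡⟨ eq ν Pν ⟩
    multiplicity ν (q₁ ++ μ ∷ q₂)                     ≡⟨ multiplicity-shift ν μ q₁ q₂ ⟩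
    multiplicity ν (μ ∷ q₁ ++ q₂)                     ≡⟨ multiplicity-++ ν [ μ ] (q₁ ++ q₂) ⟩
    multiplicity ν [ μ ] + multiplicity ν (q₁ ++ q₂)  ∎)
    where open ≡.≡-Reasoning

-- Degree bounds

ExponentsAtMost : ℕ → Monomial s → Set
ExponentsAtMost d = VAll.All (_≤ d)

-- Satisfied by d-fold products of multilinear polynomials in s variables that
-- have at most 2 ^ s terms each.
record Bounded (d : ℕ) (p : ℕPoly s) : Set where
  constructor _,_
  field
    exponents : All (ExponentsAtMost d) p
    terms     : length p ≤ 2 ^ (s * d)
open Bounded

Bounded-mono : {p : ℕPoly s} → d ≤ e → Bounded d p → Bounded e p
Bounded-mono {s} d≤e (ex , len) =
  All.map (VAll.map λ x≤d → ≤-trans x≤d d≤e) ex ,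
  ≤-trans len (^-monoʳ-≤ 2 (*-monoʳ-≤ s d≤e))

Bounded-one : Bounded 0 (one {s})
Bounded-one {s} = VAll-replicate s ∷ [] , m^n>0 2 (s * 0)
  where
  VAll-replicate : ∀ s → ExponentsAtMost 0 (Vec.replicate s 0)
  VAll-replicate zero    = []
  VAll-replicate (suc s) = z≤n ∷ VAll-replicate s

length-⊗ : (p q : ℕPoly s) → length (p ⊗ q) ≡ length p * length q
length-⊗ []      q = refl
length-⊗ (μ ∷ p) q = trans (length-++ (List.map (Vec.zipWith _+_ μ) q))
  (cong₂ _+_ (length-map (Vec.zipWith _+_ μ) q) (length-⊗ p q))

ExponentsAtMost-+ : {μ ν : Monomial s} → ExponentsAtMost d μ → ExponentsAtMost e ν →
                    ExponentsAtMost (d + e) (Vec.zipWith _+_ μ ν)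
ExponentsAtMost-+ []       []       = []
ExponentsAtMost-+ (x ∷ xs) (y ∷ ys) = +-mono-≤ x y ∷ ExponentsAtMost-+ xs ys

Bounded-⊗ : {p q : ℕPoly s} → Bounded d p → Bounded e q → Bounded (d + e) (p ⊗ q)
Bounded-⊗ {s} {d} {e} {p} {q} (exp , lenp) (exq , lenq) =
  cartesianProductWith⁺ (≡.setoid _) (≡.setoid _) _ p q
    (λ x∈p y∈q → ExponentsAtMost-+ (All.lookup exp x∈p) (All.lookup exq y∈q)) ,
  (begin
    length (p ⊗ q)                ≡⟨ length-⊗ p q ⟩
    length p * length q           ≤⟨ *-mono-≤ lenp lenq ⟩
    2 ^ (s * d) * 2 ^ (s * e)     ≡⟨ ^-distribˡ-+-* 2 (s * d) (s * e) ⟨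
    2 ^ (s * d + s * e)           ≡⟨ cong (2 ^_) (*-distribˡ-+ s d e) ⟨
    2 ^ (s * (d + e))             ∎)
  where open ≤-Reasoning

Bounded-⊗^ : {p : ℕPoly s} → Bounded 1 p → ∀ k → Bounded k (p ⊗^ k)
Bounded-⊗^ bp zero    = Bounded-one
Bounded-⊗^ bp (suc k) = Bounded-⊗ bp (Bounded-⊗^ bp k)

Bounded-∏ : ∀ d (p : Fin k → ℕPoly s) → (∀ i → Bounded d (p i)) → Bounded (k * d) (∏ (tabulate p))
Bounded-∏ {zero}  d p bp = Bounded-one
Bounded-∏ {suc k} d p bp = Bounded-⊗ (bp zero) (Bounded-∏ d (p ∘ suc) (bp ∘ suc))

Bounded-monomialPoly : (e : Vec (Vec ℕ n) n) → (∀ i j → lookup (lookup e i) j ≤ d) →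
  (X : Fin n → Fin n → ℕPoly s) → (∀ i j → Bounded 1 (X i j)) →
  Bounded (n * (n * d)) (monomialPoly e X)
Bounded-monomialPoly e e≤d X bX =
  Bounded-∏ _ _ λ i → Bounded-∏ _ _ λ j → Bounded-mono (e≤d i j) (Bounded-⊗^ (bX i j) _)

subsetSum-exponents : (b : Fin m → Fin 2) (p : Fin m → ℕPoly s) → (∀ i → Bounded d (p i)) →
                      All (ExponentsAtMost d) (subsetSum b p)
subsetSum-exponents {zero}  b p bp = []
subsetSum-exponents {suc m} b p bp =
  ++⁺ (part (b zero)) (subsetSum-exponents (b ∘ suc) (p ∘ suc) (bp ∘ suc))
  where
  part : ∀ x → All _ (choose x (p zero))
  part zero    = []
  part (suc _) = exponents (bp zero)

length-subsetSum : (b : Fin m → Fin 2) (p : Fin m → ℕPoly s) → (∀ i → Bounded d (p i)) →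
                   length (subsetSum b p) ≤ m * 2 ^ (s * d)
length-subsetSum {zero}  b p bp = z≤n
length-subsetSum {suc m} {s} {d} b p bp = begin
  length (choose (b zero) (p zero) ++ rest)          ≡⟨ length-++ (choose (b zero) (p zero)) ⟩
  length (choose (b zero) (p zero)) + length rest    ≤⟨ +-mono-≤ (part (b zero)) (length-subsetSum (b ∘ suc) (p ∘ suc) (bp ∘ suc)) ⟩
  2 ^ (s * d) + m * 2 ^ (s * d)                      ∎
  where
  open ≤-Reasoning
  rest : ℕPoly s
  rest = subsetSum (b ∘ suc) (p ∘ suc)
  part : ∀ x → length (choose x (p zero)) ≤ 2 ^ (s * d)
  part zero    = z≤n
  part (suc _) = terms (bp zero)

-- Circuit skeletons

-- Straight-line programs: wires of a program with i operations are numbered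
-- backwards in time; wire i is constantly 0 and is followed by the inputs.  The
-- operation (u , v) creates the wire u + αᵢ v for a fresh label variable αᵢ.
Wire : ℕ → ℕ → Set
Wire n i = Fin (i + suc n)

Skeleton : ℕ → ℕ → Set
Skeleton n zero    = ⊤
Skeleton n (suc i) = Skeleton n i × Wire n i × Wire n i

skeletons : ℕ → ℕ → ℕ
skeletons n zero    = 1
skeletons n (suc i) = skeletons n i * ((i + suc n) * (i + suc n))

Skeleton-↪-Fin : ∀ n i → Skeleton n i ↪ Fin (skeletons n i)
Skeleton-↪-Fin n zero    = mk↪ {to = λ _ → zero} {from = λ _ → tt} λ _ → refl
Skeleton-↪-Fin n (suc i) = ×-↪-Fin (Skeleton-↪-Fin n i) (×-↪-Fin (↪-id _) (↪-id _))

zeroWire : ∀ n i → Wire n i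
zeroWire n i = i ↑ʳ zero

-- The coefficient of input `k` in the form on the wire, as a polynomial in the labels. The newest
-- label is the head variable: prefixing 0 reuses an older polynomial, prefixing 1 multiplies it by
-- the new label. The base case tests indices as `unitForm` does.
wirePoly : ∀ i → Skeleton n i → Wire n i → Fin n → ℕPoly i
wirePoly zero    _           zero    k = []
wirePoly zero    _           (suc r) k = if toℕ r ≡ᵇ toℕ k then [ [] ] else []
wirePoly (suc i) (P , u , v) zero    k =
  List.map (0 ∷_) (wirePoly i P u k) ++ List.map (1 ∷_) (wirePoly i P v k)
wirePoly (suc i) (P , _)     (suc w) k = List.map (0 ∷_) (wirePoly i P w k)

wirePoly-zeroWire : ∀ i (P : Skeleton n i) k → wirePoly i P (zeroWire n i) k ≡ []
wirePoly-zeroWire zero    P       k = refl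
wirePoly-zeroWire (suc i) (P , _) k = cong (List.map (0 ∷_)) (wirePoly-zeroWire i P k)

-- Labels are fresh: a new one only multiplies a polynomial in the older ones, so no label is ever
-- squared.
wirePoly-exponents : ∀ i (P : Skeleton n i) w k → All (ExponentsAtMost 1) (wirePoly i P w k)
wirePoly-exponents zero _ zero k = []
wirePoly-exponents zero _ (suc r) k with toℕ r ≡ᵇ toℕ k
... | true  = [] ∷ []
... | false = []
wirePoly-exponents (suc i) (P , u , v) zero k =
  ++⁺ (map⁺ (All.map (z≤n ∷_) (wirePoly-exponents i P u k)))
      (map⁺ (All.map (≤-refl ∷_) (wirePoly-exponents i P v k)))
wirePoly-exponents (suc i) (P , _) (suc w) k =
  map⁺ (All.map (z≤n ∷_) (wirePoly-exponents i P w k))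

-- An operation concatenates two earlier lists, so the number of terms at most doubles.
length-wirePoly : ∀ i (P : Skeleton n i) w k → length (wirePoly i P w k) ≤ 2 ^ i
length-wirePoly zero _ zero k = z≤n
length-wirePoly zero _ (suc r) k with toℕ r ≡ᵇ toℕ k
... | true  = ≤-refl
... | false = z≤n
length-wirePoly (suc i) (P , u , v) zero k = begin
  length (List.map (0 ∷_) pu ++ List.map (1 ∷_) pv)            ≡⟨ length-++ (List.map (0 ∷_) pu) ⟩
  length (List.map (0 ∷_) pu) + length (List.map (1 ∷_) pv)    ≡⟨ cong₂ _+_ (length-map (0 ∷_) pu) (length-map (1 ∷_) pv) ⟩
  length pu + length pv    ≤⟨ +-mono-≤ (length-wirePoly i P u k) (length-wirePoly i P v k) ⟩
  2 ^ i + 2 ^ i            ≡⟨ cong (2 ^ i +_) (+-identityʳ (2 ^ i)) ⟨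
  2 ^ suc i                ∎
  where
  open ≤-Reasoning
  pu pv : ℕPoly i
  pu = wirePoly i P u k
  pv = wirePoly i P v k
length-wirePoly (suc i) (P , _) (suc w) k = begin
  length (List.map (0 ∷_) (wirePoly i P w k))  ≡⟨ length-map (0 ∷_) (wirePoly i P w k) ⟩
  length (wirePoly i P w k)                    ≤⟨ length-wirePoly i P w k ⟩
  2 ^ i                                        ≤⟨ ^-monoʳ-≤ 2 (n≤1+n i) ⟩
  2 ^ suc i                                    ∎
  where open ≤-Reasoning

Bounded-wirePoly : ∀ i (P : Skeleton n i) w k → Bounded 1 (wirePoly i P w k)
Bounded-wirePoly i P w k =
  wirePoly-exponents i P w k ,
  subst (λ x → length (wirePoly i P w k) ≤ 2 ^ x) (sym (*-identityʳ i)) (length-wirePoly i P w k)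

outputPoly : Skeleton n s → Vec (Wire n s) n → Fin n → Fin n → ℕPoly s
outputPoly {s = s} P outs j k = wirePoly s P (lookup outs j) k

-- Counting

-- The number of exponent matrices with entries below `n`, as an iterated power so that `finToFun`
-- decodes first the rows and then their entries.
unknowns : ℕ → ℕ
unknowns n = (n ^ n) ^ n

operations : ℕ → ℕ
operations n = n * n / 200

-- Serves twice: as bound on the total degree in the matrix entries, and as bound on the exponent of
-- each label after substitution of the multilinear outputs.
maxDegree : ℕ → ℕ
maxDegree n = n * (n * n)

cells : ℕ → ℕ
cells n = let t = operations n in skeletons n t * (t + suc n) ^ n * suc (maxDegree n) ^ t

maxMultiplicity : ℕ → ℕ
maxMultiplicity n = unknowns n * 2 ^ (operations n * maxDegree n)

m≤2^m : ∀ m → m ≤ 2 ^ m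
m≤2^m zero    = z≤n
m≤2^m (suc m) = begin
  1 + m           ≤⟨ +-mono-≤ (m^n>0 2 m) (m≤2^m m) ⟩
  2 ^ m + 2 ^ m   ≡⟨ cong (2 ^ m +_) (+-identityʳ (2 ^ m)) ⟨
  2 ^ suc m       ∎
  where open ≤-Reasoning

suc-≤-* : ∀ {m n} → 2 ≤ m → 0 < n → suc n ≤ m * n
suc-≤-* {m} {n} 2≤m 0<n = begin
  1 + n   ≤⟨ +-monoˡ-≤ n 0<n ⟩
  n + n   ≡⟨ cong (n +_) (+-identityʳ n) ⟨
  2 * n   ≤⟨ *-monoˡ-≤ n 2≤m ⟩
  m * n   ∎
  where open ≤-Reasoning

skeletons-≤ : ∀ n i {t} → i + suc n ≤ t → skeletons n i ≤ (t * t) ^ i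
skeletons-≤ n zero    _  = ≤-refl
skeletons-≤ n (suc i) {t} le = begin
  skeletons n i * ((i + suc n) * (i + suc n))  ≤⟨ *-mono-≤ (skeletons-≤ n i le′) (*-mono-≤ le′ le′) ⟩
  (t * t) ^ i * (t * t)                        ≡⟨ *-comm ((t * t) ^ i) (t * t) ⟩
  (t * t) ^ suc i                              ∎
  where
  open ≤-Reasoning
  le′ : i + suc n ≤ t
  le′ = ≤-trans (n≤1+n _) le

module _ {n : ℕ} (10≤n : 10 ≤ n) where
  open ≤-Reasoning
  private
    t c : ℕ
    t = operations n
    c = maxDegree n

    instance
      n≢0 : ℕ-NonZero n
      n≢0 = >-nonZero (≤-trans z<s 10≤n)

    2≤n : 2 ≤ n
    2≤n = ≤-trans (s≤s (s≤s z≤n)) 10≤n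

    ≤-half : ∀ x y {z} → 2 * x ≤ z → 2 * y ≤ z → x + y ≤ z
    ≤-half x y {z} 2x≤z 2y≤z = *-cancelˡ-≤ 2 (begin
      2 * (x + y)    ≡⟨ *-distribˡ-+ 2 x y ⟩
      2 * x + 2 * y  ≤⟨ +-mono-≤ 2x≤z 2y≤z ⟩
      z + z          ≡⟨ cong (z +_) (+-identityʳ z) ⟨
      2 * z          ∎)

    operations-≤ : ∀ k → k ≤ 200 → k * t ≤ n * n
    operations-≤ k k≤200 = begin
      k * t    ≤⟨ *-monoˡ-≤ t k≤200 ⟩
      200 * t  ≡⟨ *-comm 200 t ⟩
      t * 200  ≤⟨ m/n*n≤m (n * n) 200 ⟩
      n * n    ∎

    -- The lower-order terms take at most half of `n * n`; `10 ≤ n` enters through 14 ≤ 2 * n and 6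
    -- ≤ n.
    linear-≤ : 2 * (7 + 2 * n) ≤ n * n
    linear-≤ = begin
      2 * (7 + 2 * n)    ≡⟨ *-distribˡ-+ 2 7 (2 * n) ⟩
      14 + 2 * (2 * n)   ≤⟨ +-monoˡ-≤ (2 * (2 * n)) (≤-trans (m≤m+n 14 6) (*-monoʳ-≤ 2 10≤n)) ⟩
      2 * n + 2 * (2 * n)  ≡⟨ cong (2 * n +_) (*-assoc 2 2 n) ⟨
      2 * n + 4 * n      ≡⟨ *-distribʳ-+ n 2 4 ⟨
      6 * n              ≤⟨ *-monoˡ-≤ n (≤-trans (m≤m+n 6 4) 10≤n) ⟩
      n * n              ∎

    n*n≡n^2 : n * n ≡ n ^ 2
    n*n≡n^2 = cong (n *_) (sym (*-identityʳ n))

    c≡n^3 : c ≡ n ^ 3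
    c≡n^3 = cong (n *_) n*n≡n^2

    wires-≤ : t + suc n ≤ n ^ 2
    wires-≤ = subst (t + suc n ≤_) n*n≡n^2 (≤-half t (suc n) (operations-≤ 2 (m≤m+n 2 198)) (begin
      2 * suc n        ≤⟨ *-monoʳ-≤ 2 (+-mono-≤ (m≤m+n 1 6) (m≤m+n n (n + 0))) ⟩
      2 * (7 + 2 * n)  ≤⟨ linear-≤ ⟩
      n * n            ∎))

    -- These are exponents of `n`: 6 for the bit length of a count, `4 * t` for the skeletons,
    -- `2 * n` for the outputs, `4 * t` for the label monomials. As `16 * t ≤ n * n`, the terms in
    -- `t` fit in one half of `n * n`, and `linear-≤` puts the rest in the other.
    exponent-< : 6 + (4 * t + 2 * n + 4 * t) < n * n
    exponent-< = begin
      7 + (4 * t + 2 * n + 4 * t)    ≡⟨ rearrange t n ⟩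
      8 * t + (7 + 2 * n)            ≤⟨ ≤-half (8 * t) (7 + 2 * n) (≤-trans (≤-reflexive (sym (*-assoc 2 8 t))) (operations-≤ 16 (m≤m+n 16 184))) linear-≤ ⟩
      n * n                          ∎
      where
      rearrange : ∀ t n → 7 + (4 * t + 2 * n + 4 * t) ≡ 8 * t + (7 + 2 * n)
      rearrange = solve-∀

    -- Each operation picks two wires and each output one, out of at most `n ^ 2`; each label
    -- exponent has `suc c ≤ n ^ 4` possible values.
    cells-≤ : cells n ≤ n ^ (4 * t + 2 * n + 4 * t)
    cells-≤ = begin
      skeletons n t * (t + suc n) ^ n * suc c ^ t
        ≤⟨ *-mono-≤ (*-mono-≤ (skeletons-≤ n t wires-≤) (^-monoˡ-≤ n wires-≤)) (^-monoˡ-≤ t suc-c-≤) ⟩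
      (n ^ 2 * n ^ 2) ^ t * (n ^ 2) ^ n * (n ^ 4) ^ t
        ≡⟨ cong (λ x → x ^ t * (n ^ 2) ^ n * (n ^ 4) ^ t) (^-distribˡ-+-* n 2 2) ⟨
      (n ^ 4) ^ t * (n ^ 2) ^ n * (n ^ 4) ^ t
        ≡⟨ cong₂ _*_ (cong₂ _*_ (^-*-assoc n 4 t) (^-*-assoc n 2 n)) (^-*-assoc n 4 t) ⟩
      n ^ (4 * t) * n ^ (2 * n) * n ^ (4 * t)
        ≡⟨ cong (_* n ^ (4 * t)) (^-distribˡ-+-* n (4 * t) (2 * n)) ⟨
      n ^ (4 * t + 2 * n) * n ^ (4 * t)
        ≡⟨ ^-distribˡ-+-* n (4 * t + 2 * n) (4 * t) ⟨
      n ^ (4 * t + 2 * n + 4 * t) ∎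
      where
      suc-c-≤ : suc c ≤ n ^ 4
      suc-c-≤ = subst (λ x → suc x ≤ n ^ 4) (sym c≡n^3) (suc-≤-* 2≤n (m^n>0 n 3))

    unknowns-≤ : unknowns n ≤ 2 ^ c
    unknowns-≤ = begin
      (n ^ n) ^ n        ≤⟨ ^-monoˡ-≤ n (^-monoˡ-≤ n (m≤2^m n)) ⟩
      ((2 ^ n) ^ n) ^ n  ≡⟨ cong (_^ n) (^-*-assoc 2 n n) ⟩
      (2 ^ (n * n)) ^ n  ≡⟨ ^-*-assoc 2 (n * n) n ⟩
      2 ^ (n * n * n)    ≡⟨ cong (2 ^_) (*-assoc n n n) ⟩
      2 ^ c              ∎

    -- By `m≤2^m` the factor `unknowns n` is at most `2 ^ c`, so the binary exponents add up to
    -- `suc t * c ≤ n ^ 5`; a further factor `n` absorbs the successor.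
    maxMultiplicity-≤ : suc (maxMultiplicity n) ≤ 2 ^ (n ^ 6)
    maxMultiplicity-≤ = begin
      suc (unknowns n * 2 ^ (t * c))  ≤⟨ s≤s (*-monoˡ-≤ (2 ^ (t * c)) unknowns-≤) ⟩
      suc (2 ^ c * 2 ^ (t * c))       ≡⟨ cong suc (^-distribˡ-+-* 2 c (t * c)) ⟨
      suc (2 ^ (suc t * c))           ≤⟨ suc-≤-* ≤-refl (m^n>0 2 (suc t * c)) ⟩
      2 ^ suc (suc t * c)             ≤⟨ ^-monoʳ-≤ 2 exponent-≤ ⟩
      2 ^ (n ^ 6)                     ∎
      where
      exponent-≤ : suc (suc t * c) ≤ n ^ 6
      exponent-≤ = begin
        suc (suc t * c)      ≤⟨ s≤s (*-monoˡ-≤ c (≤-trans (≤-trans (≤-reflexive (+-comm 1 t)) (+-monoʳ-≤ t (s≤s z≤n))) wires-≤)) ⟩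
        suc (n ^ 2 * c)      ≡⟨ cong (λ x → suc (n ^ 2 * x)) c≡n^3 ⟩
        suc (n ^ 2 * n ^ 3)  ≡⟨ cong suc (^-distribˡ-+-* n 2 3) ⟨
        suc (n ^ 5)          ≤⟨ suc-≤-* 2≤n (m^n>0 n 5) ⟩
        n ^ 6                ∎

  -- Comparing exponents of 2 leaves `n ^ 6 * cells n < unknowns n`; comparing exponents of `n` then
  -- leaves `exponent-<`.
  fewer-values-than-subsets : suc (maxMultiplicity n) ^ cells n < 2 ^ unknowns n
  fewer-values-than-subsets = begin-strict
    suc (maxMultiplicity n) ^ cells n  ≤⟨ ^-monoˡ-≤ (cells n) maxMultiplicity-≤ ⟩
    (2 ^ (n ^ 6)) ^ cells n            ≡⟨ ^-*-assoc 2 (n ^ 6) (cells n) ⟩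
    2 ^ (n ^ 6 * cells n)              <⟨ ^-monoʳ-< 2 ≤-refl (begin-strict
      n ^ 6 * cells n                            ≤⟨ *-monoʳ-≤ (n ^ 6) cells-≤ ⟩
      n ^ 6 * n ^ (4 * t + 2 * n + 4 * t)        ≡⟨ ^-distribˡ-+-* n 6 (4 * t + 2 * n + 4 * t) ⟨
      n ^ (6 + (4 * t + 2 * n + 4 * t))          <⟨ ^-monoʳ-< n 2≤n exponent-< ⟩
      n ^ (n * n)                                ≡⟨ ^-*-assoc n n n ⟨
      unknowns n                                 ∎) ⟩
    2 ^ unknowns n                     ∎

-- The monomials of the equation

entry : ∀ n → Fin (unknowns n) → Fin n → Fin n → Fin n
entry n x j k = finToFun {n} {n} (finToFun {n ^ n} {n} x j) k

exponent : ∀ n → Fin (unknowns n) → Vec (Vec ℕ n) n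
exponent n x = tabulate λ j → tabulate λ k → toℕ (entry n x j k)

lookup-exponent : ∀ n (x : Fin (unknowns n)) (j k : Fin n) →
                  lookup (lookup (exponent n x) j) k ≡ toℕ (entry n x j k)
lookup-exponent n x j k = trans
  (cong (λ r → lookup r k) (lookup∘tabulate (λ j → tabulate λ k → toℕ (entry n x j k)) j))
  (lookup∘tabulate (λ k → toℕ (entry n x j k)) k)

exponent-≤ : ∀ n (x : Fin (unknowns n)) (j k : Fin n) → lookup (lookup (exponent n x) j) k ≤ n
exponent-≤ n x j k = subst (_≤ n) (sym (lookup-exponent n x j k)) (<⇒≤ (toℕ<n (entry n x j k)))

exponent-injective : ∀ n {x y : Fin (unknowns n)} → exponent n x ≡ exponent n y → x ≡ y
exponent-injective n {x} {y} eq = finToFun-injective n λ j → finToFun-injective n λ k →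
  toℕ-injective (trans (sym (lookup-exponent n x j k))
    (trans (cong (λ e → lookup (lookup e j) k) eq) (lookup-exponent n y j k)))

Pointwise-∷ʳ : ∀ {a b r} {A : Set a} {B : Set b} {R : A → B → Set r} {xs : Vec A m} {ys : Vec B m} {x y} →
               Pointwise R xs ys → R x y → Pointwise R (xs ∷ʳ x) (ys ∷ʳ y)
Pointwise-∷ʳ []        r = r ∷ []
Pointwise-∷ʳ (q ∷ qs) r = q ∷ Pointwise-∷ʳ qs r

-- Interpretation in a field

module _ {c ℓ : Level} (F : Field c ℓ) where
  private module F = Field F
  open Field F
    using (Carrier; _≈_; 0#; 1#; -_; _-_; +-cong; *-cong; -‿cong; +-congˡ; +-congʳ; *-congˡ; *-congʳ;
           zeroˡ; zeroʳ; distribˡ; distribʳ; -‿inverseʳ; 0≉1)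
    renaming (_+_ to _⊕_; _*_ to _·_; refl to ≈-refl; sym to ≈-sym; trans to ≈-trans; reflexive to ≈-reflexive)
  open SetoidReasoning F.setoid
  open import Algebra.Properties.Ring F.ring using (-‿distribˡ-*; -‿+-comm; -0#≈0#)
  open import Algebra.Properties.CommutativeSemigroup F.+-commutativeSemigroup using (x∙yz≈y∙xz; interchange)
  open import Algebra.Properties.CommutativeSemigroup F.*-commutativeSemigroup using () renaming (interchange to *-interchange)

  private
    pow-+ : ∀ x m n → pow F x (m + n) ≈ pow F x m · pow F x n
    pow-+ x zero    n = ≈-sym (F.*-identityˡ _)
    pow-+ x (suc m) n = ≈-trans (*-congˡ (pow-+ x m n)) (≈-sym (F.*-assoc _ _ _))

    pow-cong : ∀ {x y} → x ≈ y → ∀ k → pow F x k ≈ pow F y k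
    pow-cong x≈y zero    = ≈-refl
    pow-cong x≈y (suc k) = *-cong x≈y (pow-cong x≈y k)

    prodF-cong : {f g : Fin k → Carrier} → (∀ i → f i ≈ g i) → prodF F (tabulate f) ≈ prodF F (tabulate g)
    prodF-cong {zero}  f≈g = ≈-refl
    prodF-cong {suc k} f≈g = *-cong (f≈g zero) (prodF-cong (f≈g ∘ suc))

    evalMono-cong : (e : Exponent F n) {A B : Matrix F n} → (∀ i j → A i j ≈ B i j) → evalMono F e A ≈ evalMono F e B
    evalMono-cong e A≈B = prodF-cong λ i → prodF-cong λ j → pow-cong (A≈B i j) (lookup (lookup e i) j)

  -- Evaluation of polynomials with natural coefficients

  evalMonomial : Vec Carrier s → Monomial s → Carrier
  evalMonomial []      []      = 1#
  evalMonomial (a ∷ α) (e ∷ μ) = pow F a e · evalMonomial α μ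

  evalℕ : Vec Carrier s → ℕPoly s → Carrier
  evalℕ α []      = 0#
  evalℕ α (μ ∷ p) = evalMonomial α μ ⊕ evalℕ α p

  evalℕ-++ : (α : Vec Carrier s) (p q : ℕPoly s) → evalℕ α (p ++ q) ≈ evalℕ α p ⊕ evalℕ α q
  evalℕ-++ α []      q = ≈-sym (F.+-identityˡ _)
  evalℕ-++ α (μ ∷ p) q = ≈-trans (+-congˡ (evalℕ-++ α p q)) (≈-sym (F.+-assoc _ _ _))

  -- By commutativity of addition the value depends only on the multiplicities. This is how
  -- equalities between counts reach the field.
  evalℕ-↭ : (α : Vec Carrier s) {p q : ℕPoly s} → p ↭ q → evalℕ α p ≈ evalℕ α q
  evalℕ-↭ α ↭-refl′          = ≈-refl
  evalℕ-↭ α (prep μ p↭q)     = +-congˡ (evalℕ-↭ α p↭q)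
  evalℕ-↭ α (swap μ ν p↭q)   = ≈-trans (x∙yz≈y∙xz _ _ _) (+-congˡ (+-congˡ (evalℕ-↭ α p↭q)))
  evalℕ-↭ α (↭-trans′ p↭q q↭r) = ≈-trans (evalℕ-↭ α p↭q) (evalℕ-↭ α q↭r)

  evalMonomial-+ : (α : Vec Carrier s) (μ ν : Monomial s) →
    evalMonomial α (Vec.zipWith _+_ μ ν) ≈ evalMonomial α μ · evalMonomial α ν
  evalMonomial-+ []      []      []      = ≈-sym (F.*-identityˡ _)
  evalMonomial-+ (a ∷ α) (d ∷ μ) (e ∷ ν) =
    ≈-trans (*-cong (pow-+ a d e) (evalMonomial-+ α μ ν)) (*-interchange _ _ _ _)

  evalMonomial-0 : (α : Vec Carrier s) → evalMonomial α (Vec.replicate s 0) ≈ 1#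
  evalMonomial-0 []      = ≈-refl
  evalMonomial-0 (a ∷ α) = ≈-trans (F.*-identityˡ _) (evalMonomial-0 α)

  evalℕ-one : (α : Vec Carrier s) → evalℕ α one ≈ 1#
  evalℕ-one α = ≈-trans (F.+-identityʳ _) (evalMonomial-0 α)

  evalℕ-shift : (α : Vec Carrier s) (μ : Monomial s) (q : ℕPoly s) →
    evalℕ α (List.map (Vec.zipWith _+_ μ) q) ≈ evalMonomial α μ · evalℕ α q
  evalℕ-shift α μ []      = ≈-sym (zeroʳ _)
  evalℕ-shift α μ (ν ∷ q) =
    ≈-trans (+-cong (evalMonomial-+ α μ ν) (evalℕ-shift α μ q)) (≈-sym (distribˡ _ _ _))

  evalℕ-⊗ : (α : Vec Carrier s) (p q : ℕPoly s) → evalℕ α (p ⊗ q) ≈ evalℕ α p · evalℕ α q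
  evalℕ-⊗ α []      q = ≈-sym (zeroˡ _)
  evalℕ-⊗ α (μ ∷ p) q = begin
    evalℕ α (List.map (Vec.zipWith _+_ μ) q ++ p ⊗ q)        ≈⟨ evalℕ-++ α (List.map (Vec.zipWith _+_ μ) q) (p ⊗ q) ⟩
    evalℕ α (List.map (Vec.zipWith _+_ μ) q) ⊕ evalℕ α (p ⊗ q)  ≈⟨ +-cong (evalℕ-shift α μ q) (evalℕ-⊗ α p q) ⟩
    evalMonomial α μ · evalℕ α q ⊕ evalℕ α p · evalℕ α q     ≈⟨ distribʳ _ _ _ ⟨
    (evalMonomial α μ ⊕ evalℕ α p) · evalℕ α q               ∎

  evalℕ-⊗^ : (α : Vec Carrier s) (p : ℕPoly s) → ∀ k → evalℕ α (p ⊗^ k) ≈ pow F (evalℕ α p) k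
  evalℕ-⊗^ α p zero    = evalℕ-one α
  evalℕ-⊗^ α p (suc k) = ≈-trans (evalℕ-⊗ α p (p ⊗^ k)) (*-congˡ (evalℕ-⊗^ α p k))

  evalℕ-∏ : (α : Vec Carrier s) (p : Fin k → ℕPoly s) →
            evalℕ α (∏ (tabulate p)) ≈ prodF F (tabulate (evalℕ α ∘ p))
  evalℕ-∏ {k = zero}  α p = evalℕ-one α
  evalℕ-∏ {k = suc k} α p = ≈-trans (evalℕ-⊗ α (p zero) _) (*-congˡ (evalℕ-∏ α (p ∘ suc)))

  evalℕ-monomialPoly : (α : Vec Carrier s) (e : Exponent F n) (X : Fin n → Fin n → ℕPoly s) →
    evalℕ α (monomialPoly e X) ≈ evalMono F e (λ i j → evalℕ α (X i j))
  evalℕ-monomialPoly α e X = ≈-trans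
    (evalℕ-∏ α λ i → ∏ (tabulate λ j → X i j ⊗^ lookup (lookup e i) j))
    (prodF-cong λ i → ≈-trans
      (evalℕ-∏ α λ j → X i j ⊗^ lookup (lookup e i) j)
      (prodF-cong λ j → evalℕ-⊗^ α (X i j) (lookup (lookup e i) j)))

  evalℕ-map-0∷ : ∀ a (α : Vec Carrier s) p → evalℕ (a ∷ α) (List.map (0 ∷_) p) ≈ evalℕ α p
  evalℕ-map-0∷ a α []      = ≈-refl
  evalℕ-map-0∷ a α (μ ∷ p) = +-cong (F.*-identityˡ _) (evalℕ-map-0∷ a α p)

  evalℕ-map-1∷ : ∀ a (α : Vec Carrier s) p → evalℕ (a ∷ α) (List.map (1 ∷_) p) ≈ a · evalℕ α p
  evalℕ-map-1∷ a α []      = ≈-sym (zeroʳ _)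
  evalℕ-map-1∷ a α (μ ∷ p) =
    ≈-trans (+-cong (*-congʳ (F.*-identityʳ a)) (evalℕ-map-1∷ a α p)) (≈-sym (distribˡ _ _ _))

  -- Circuits as labelled skeletons

  record Represents {n : ℕ} (i : ℕ) (P : Skeleton n i) (α : Vec Carrier i)
                    (w : Wire n i) (f : LinForm F n) : Set ℓ where
    constructor represents
    field
      at : ∀ k → evalℕ α (wirePoly i P w k) ≈ lookup f k
  open Represents

  -- All nodes are tracked at once, since a later gate may refer to any of them. The field `wires`
  -- translates node numbers, which grow with time, into wire numbers, which run backwards.
  record Realization {n N : ℕ} (i : ℕ) (fs : Vec (LinForm F n) N) : Set (c ⊔ ℓ) where
    constructor realize
    field
      skeleton : Skeleton n i
      labels   : Vec Carrier i
      wires    : Vec (Wire n i) N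
      correct  : Pointwise (Represents i skeleton labels) wires fs

  Represents-suc : ∀ {P : Skeleton n i} {α} a u v {w f} → Represents i P α w f →
                   Represents (suc i) (P , u , v) (a ∷ α) (suc w) f
  at (Represents-suc {α = α} a u v {w} rep) k =
    ≈-trans (evalℕ-map-0∷ a α (wirePoly _ _ w k)) (at rep k)

  Pointwise-Represents-suc : ∀ {N} {P : Skeleton n i} {α} a u v {ρ : Vec _ N} {fs : Vec _ N} →
    Pointwise (Represents i P α) ρ fs →
    Pointwise (Represents (suc i) (P , u , v) (a ∷ α)) (Vec.map suc ρ) fs
  Pointwise-Represents-suc a u v []           = []
  Pointwise-Represents-suc a u v (rep ∷ reps) =
    Represents-suc a u v rep ∷ Pointwise-Represents-suc a u v reps

  Represents-zero : ∀ {P : Skeleton n i} {α} a {u v f g} →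
    Represents i P α u f → Represents i P α v g →
    Represents (suc i) (P , u , v) (a ∷ α) zero (Vec.zipWith _⊕_ (Vec.map (a ·_) g) f)
  at (Represents-zero {i = i} {P} {α} a {u} {v} {f} {g} repᵤ repᵥ) k = begin
    evalℕ (a ∷ α) (List.map (0 ∷_) pu ++ List.map (1 ∷_) pv)                     ≈⟨ evalℕ-++ (a ∷ α) (List.map (0 ∷_) pu) _ ⟩
    evalℕ (a ∷ α) (List.map (0 ∷_) pu) ⊕ evalℕ (a ∷ α) (List.map (1 ∷_) pv)      ≈⟨ +-cong (evalℕ-map-0∷ a α pu) (evalℕ-map-1∷ a α pv) ⟩
    evalℕ α pu ⊕ a · evalℕ α pv     ≈⟨ +-cong (at repᵤ k) (*-congˡ (at repᵥ k)) ⟩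
    lookup f k ⊕ a · lookup g k     ≈⟨ F.+-comm _ _ ⟩
    a · lookup g k ⊕ lookup f k     ≡⟨ cong (_⊕ lookup f k) (lookup-map k (a ·_) g) ⟨
    lookup (Vec.map (a ·_) g) k ⊕ lookup f k   ≡⟨ lookup-zipWith _⊕_ k (Vec.map (a ·_) g) f ⟨
    lookup (Vec.zipWith _⊕_ (Vec.map (a ·_) g) f) k   ∎
    where
    pu pv : ℕPoly i
    pu = wirePoly i P u k
    pv = wirePoly i P v k

  Represents-zeroForm : ∀ {P : Skeleton n i} {α} → Represents i P α (zeroWire n i) (zeroForm F)
  at (Represents-zeroForm {n} {i} {P} {α}) k = begin
    evalℕ α (wirePoly i P (zeroWire n i) k)  ≡⟨ cong (evalℕ α) (wirePoly-zeroWire i P k) ⟩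
    0#                                       ≡⟨ lookup-replicate k 0# ⟨
    lookup (zeroForm F) k                    ∎

  Represents-unitForm : ∀ (r : Fin n) → Represents 0 tt [] (suc r) (unitForm F r)
  at (Represents-unitForm r) k = ≈-trans (lemma (toℕ r ≡ᵇ toℕ k))
    (≈-reflexive (sym (lookup∘tabulate (λ j → if toℕ r ≡ᵇ toℕ j then 1# else 0#) k)))
    where
    lemma : ∀ b → evalℕ [] (if b then [ [] ] else []) ≈ (if b then 1# else 0#)
    lemma true  = F.+-identityʳ 1#
    lemma false = ≈-refl

  -- The local `step` of `forms`, restated so that the partial sums of a gate can be mentioned.
  addEdge : ∀ {N} → Vec (LinForm F n) N → Fin N × Carrier → LinForm F n → LinForm F n
  addEdge fs (v , a) acc = Vec.zipWith _⊕_ (Vec.map (a ·_) (lookup fs v)) acc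

  -- Edges are added one at a time to an accumulator that starts as the zero wire, so each edge
  -- costs exactly one operation and a gate without edges costs none.
  realize-gate : ∀ {N} {fs : Vec (LinForm F n) N} (es : List (Fin N × Carrier)) → Realization i fs →
    Σ (Realization (length es + i) fs) λ (realize P α _ _) →
      ∃ λ w → Represents _ P α w (List.foldr (addEdge fs) (zeroForm F) es)
  realize-gate []             R = R , zeroWire _ _ , Represents-zeroForm
  realize-gate ((v , a) ∷ es) R
    with realize P α ρ correct , w , rep ← realize-gate es R =
    realize (P , w , lookup ρ v) (a ∷ α) (Vec.map suc ρ)
            (Pointwise-Represents-suc a w (lookup ρ v) correct) ,
    zero , Represents-zero a rep (Pointwise.lookup correct v)

  realize-forms : ∀ {N} (g : Gates F n N) → Realization (gatesSize F g) (forms F g)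
  -- Here `suc` steps over wire 0, the constant zero.
  realize-forms inputs = realize tt [] (tabulate suc) (Pointwise.tabulate⁺ Represents-unitForm)
  realize-forms (g ▹ es) with realize P α ρ correct , w , rep ← realize-gate es (realize-forms g) =
    subst (λ i → Realization i (forms F (g ▹ es))) (+-comm (length es) (gatesSize F g))
      (realize P α (ρ ∷ʳ w) (Pointwise-∷ʳ correct rep))

  -- Idle operations 0 + 0 · 0 pad every program to the same length, so a single family of skeletons
  -- covers all smaller circuits.
  realize-≤′ : ∀ {N} {fs : Vec (LinForm F n) N} → i ≤′ s → Realization i fs → Realization s fs
  realize-≤′ (≤′-reflexive refl) R = R
  realize-≤′ (≤′-step i≤s) R with realize P α ρ correct ← realize-≤′ i≤s R =
    realize (P , zeroWire _ _ , zeroWire _ _) (0# ∷ α) (Vec.map suc ρ)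
            (Pointwise-Represents-suc 0# _ _ correct)

  -- Separates the finite data `P` and `outs`, over which the counting ranges, from the field
  -- elements `α`, which enter only through evaluation.
  computed-by-skeleton : (C : Circuit F n) (A : Matrix F n) → size F C ≤ s → Computes F C A →
    Σ (Skeleton n s) λ P → Σ (Vec (Wire n s) n) λ outs → Σ (Vec Carrier s) λ α →
      ∀ j k → A j k ≈ evalℕ α (outputPoly P outs j k)
  computed-by-skeleton {s = s} C A size≤s comp
    with realize P α ρ correct ← realize-≤′ (≤⇒≤′ size≤s) (realize-forms (Circuit.gates C)) =
    P , Vec.map (lookup ρ) outputs , α , λ j k → ≈-sym (begin
      evalℕ α (wirePoly s P (lookup (Vec.map (lookup ρ) outputs) j) k)
        ≡⟨ cong (λ w → evalℕ α (wirePoly s P w k)) (lookup-map j (lookup ρ) outputs) ⟩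
      evalℕ α (wirePoly s P (lookup ρ (lookup outputs j)) k)
        ≈⟨ at (Pointwise.lookup correct (lookup outputs j)) k ⟩
      lookup (lookup (forms F gates) (lookup outputs j)) k
        ≈⟨ comp j k ⟩
      A j k ∎)
    where open Circuit C

  -- Differences of subset sums of monomials

  indicator : Fin 2 → Carrier
  indicator zero    = 0#
  indicator (suc _) = 1#

  -- Distinct bits differ by 1 or -1, and either being zero would contradict `0≉1`.
  indicator-≢ : ∀ {x y} → x ≢ y → ¬ (indicator x - indicator y ≈ 0#)
  indicator-≢ {zero}     {zero}     x≢y _  = x≢y refl
  indicator-≢ {suc zero} {suc zero} x≢y _  = x≢y refl
  indicator-≢ {suc zero} {zero}     _   eq = 0≉1 (≈-sym (begin
    1#       ≈⟨ F.+-identityʳ 1# ⟨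
    1# ⊕ 0#  ≈⟨ +-congˡ -0#≈0# ⟨
    1# - 0#  ≈⟨ eq ⟩
    0#       ∎))
  indicator-≢ {zero} {suc zero} _ eq = 0≉1 (begin
    0#               ≈⟨ -‿inverseʳ 1# ⟨
    1# - 1#          ≈⟨ +-congˡ (≈-trans (≈-sym (F.+-identityˡ _)) eq) ⟩
    1# ⊕ 0#          ≈⟨ F.+-identityʳ 1# ⟩
    1#               ∎)

  difference : (b b′ : Fin m → Fin 2) → (Fin m → Exponent F n) → Poly F n
  difference b b′ ex = List.tabulate λ x → indicator (b x) - indicator (b′ x) , ex x

  coeff-tabulate-∉ : (a : Fin m → Carrier) (ex : Fin m → Exponent F n) {e : Exponent F n} →
    (∀ x → ex x ≢ e) → coeff F (List.tabulate λ x → a x , ex x) e ≈ 0#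
  coeff-tabulate-∉ {zero}  a ex     e∉ = ≈-refl
  coeff-tabulate-∉ {suc m} a ex {e} e∉ with ≡-dec (≡-dec _≟_) (ex zero) e
  ... | yes eq = contradiction eq (e∉ zero)
  ... | no  _  = coeff-tabulate-∉ (a ∘ suc) (ex ∘ suc) (e∉ ∘ suc)

  -- By injectivity only one term has the exponent `ex y`, so no other coefficient is added to it.
  coeff-tabulate : (a : Fin m → Carrier) (ex : Fin m → Exponent F n) →
    (∀ {x y} → ex x ≡ ex y → x ≡ y) → ∀ y → coeff F (List.tabulate λ x → a x , ex x) (ex y) ≈ a y
  coeff-tabulate {suc m} a ex inj y with ≡-dec (≡-dec _≟_) (ex zero) (ex y)
  ... | yes eq with refl ← inj eq = ≈-trans
    (+-congˡ (coeff-tabulate-∉ (a ∘ suc) (ex ∘ suc) λ x eq → contradiction (inj eq) λ ()))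
    (F.+-identityʳ _)
  coeff-tabulate {suc m} a ex inj zero    | no neq = contradiction refl neq
  coeff-tabulate {suc m} a ex inj (suc y) | no _   =
    coeff-tabulate (a ∘ suc) (ex ∘ suc) (suc-injective ∘ inj) y

  evalℕ-choose : (α : Vec Carrier s) (x : Fin 2) (p : ℕPoly s) → evalℕ α (choose x p) ≈ indicator x · evalℕ α p
  evalℕ-choose α zero    p = ≈-sym (zeroˡ _)
  evalℕ-choose α (suc _) p = ≈-sym (F.*-identityˡ _)

  -- Substitution commutes with evaluation monomial by monomial, and `choose` becomes multiplication
  -- by an indicator. Subtraction takes place in the field, as `ℕPoly` has no signs.
  eval-difference : (α : Vec Carrier s) (X : Fin n → Fin n → ℕPoly s) (A : Matrix F n) →
    (∀ j k → A j k ≈ evalℕ α (X j k)) →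
    (b b′ : Fin m → Fin 2) (ex : Fin m → Exponent F n) →
    eval F (difference b b′ ex) A ≈
      evalℕ α (subsetSum b λ x → monomialPoly (ex x) X) - evalℕ α (subsetSum b′ λ x → monomialPoly (ex x) X)
  eval-difference {m = zero}  α X A A≈ b b′ ex = ≈-sym (-‿inverseʳ 0#)
  eval-difference {m = suc m} α X A A≈ b b′ ex = begin
    (β - β′) · evalMono F (ex zero) A ⊕ eval F (difference (b ∘ suc) (b′ ∘ suc) (ex ∘ suc)) A
      ≈⟨ +-cong (*-congˡ mono≈) (eval-difference α X A A≈ (b ∘ suc) (b′ ∘ suc) (ex ∘ suc)) ⟩
    (β - β′) · v ⊕ (r - r′)
      ≈⟨ +-congʳ (≈-trans (distribʳ v β (- β′)) (+-congˡ (≈-sym (-‿distribˡ-* β′ v)))) ⟩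
    (β · v - β′ · v) ⊕ (r - r′)
      ≈⟨ interchange _ _ _ _ ⟩
    (β · v ⊕ r) ⊕ (- (β′ · v) - r′)
      ≈⟨ +-congˡ (-‿+-comm _ _) ⟩
    (β · v ⊕ r) - (β′ · v ⊕ r′)
      ≈⟨ +-cong (split b) (-‿cong (split b′)) ⟨
    evalℕ α (subsetSum b p) - evalℕ α (subsetSum b′ p) ∎
    where
    p : Fin (suc m) → ℕPoly _
    p x = monomialPoly (ex x) X
    β β′ v r r′ : Carrier
    β  = indicator (b zero)
    β′ = indicator (b′ zero)
    v  = evalℕ α (p zero)
    r  = evalℕ α (subsetSum (b ∘ suc) (p ∘ suc))
    r′ = evalℕ α (subsetSum (b′ ∘ suc) (p ∘ suc))
    mono≈ : evalMono F (ex zero) A ≈ v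
    mono≈ = ≈-trans (evalMono-cong (ex zero) A≈) (≈-sym (evalℕ-monomialPoly α (ex zero) X))
    split : ∀ b → evalℕ α (subsetSum b p) ≈ indicator (b zero) · v ⊕ evalℕ α (subsetSum (b ∘ suc) (p ∘ suc))
    split b = ≈-trans (evalℕ-++ α (choose (b zero) (p zero)) _) (+-congʳ (evalℕ-choose α (b zero) (p zero)))

  sumℕ-tabulate-≤ : (f : Fin k → ℕ) → (∀ x → f x ≤ d) → sumℕ F (tabulate f) ≤ k * d
  sumℕ-tabulate-≤ {zero}  f f≤d = z≤n
  sumℕ-tabulate-≤ {suc k} f f≤d = +-mono-≤ (f≤d zero) (sumℕ-tabulate-≤ (f ∘ suc) (f≤d ∘ suc))

  monoDeg-exponent : ∀ n (x : Fin (unknowns n)) → monoDeg F (exponent n x) ≤ maxDegree n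
  monoDeg-exponent n x = subst (λ r → sumℕ F r ≤ maxDegree n)
    (tabulate-∘ (sumℕ F) (λ j → tabulate λ k → toℕ (entry n x j k)))
    (sumℕ-tabulate-≤ (λ j → sumℕ F (tabulate (row j))) λ j →
      sumℕ-tabulate-≤ (row j) λ k → <⇒≤ (toℕ<n (entry n x j k)))
    where
    row : Fin n → Fin n → ℕ
    row j k = toℕ (entry n x j k)

-- The counts to be matched, one per skeleton, choice of outputs and label monomial

Cell : ℕ → Set
Cell n = let t = operations n in (Skeleton n t × Vec (Wire n t) n) × Vec (Fin (suc (maxDegree n))) t

Cell-↪-Fin : ∀ n → Cell n ↪ Fin (cells n)
Cell-↪-Fin n = ×-↪-Fin (×-↪-Fin (Skeleton-↪-Fin n _) (Vec-Fin-↪-Fin _ n)) (Vec-Fin-↪-Fin _ _)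

restriction : (Fin (unknowns n) → Fin 2) → Skeleton n s → Vec (Wire n s) n → ℕPoly s
restriction {n} b P outs = subsetSum b λ x → monomialPoly (exponent n x) (outputPoly P outs)

Bounded-term : (P : Skeleton n s) (outs : Vec (Wire n s) n) (x : Fin (unknowns n)) →
               Bounded (maxDegree n) (monomialPoly (exponent n x) (outputPoly P outs))
Bounded-term {n} {s} P outs x = Bounded-monomialPoly (exponent n x) (exponent-≤ n x) _ λ j k →
  Bounded-wirePoly s P (lookup outs j) k

cellValue : (Fin (unknowns n) → Fin 2) → Cell n → ℕ
cellValue b ((P , outs) , μ) = multiplicity (Vec.map toℕ μ) (restriction b P outs)

cellValue-< : (b : Fin (unknowns n) → Fin 2) (c : Cell n) → cellValue b c < suc (maxMultiplicity n)
cellValue-< b ((P , outs) , μ) = s≤s (≤-trans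
  (length-filter (≡-dec _≟_ (Vec.map toℕ μ)) (restriction b P outs))
  (length-subsetSum b _ (Bounded-term P outs)))

ExponentsAtMost⇒Fin : {μ : Monomial s} → ExponentsAtMost d μ → ∃ λ (ν : Vec (Fin (suc d)) s) → Vec.map toℕ ν ≡ μ
ExponentsAtMost⇒Fin []         = [] , refl
ExponentsAtMost⇒Fin (x≤d ∷ xs) with ν , refl ← ExponentsAtMost⇒Fin xs =
  fromℕ< (s≤s x≤d) ∷ ν , cong (_∷ _) (toℕ-fromℕ< (s≤s x≤d))

-- Cells test only exponents up to `maxDegree n`, but neither list contains a larger one, so
-- agreement on the cells is agreement on all monomials.
restriction-↭ : (b b′ : Fin (unknowns n) → Fin 2) → (∀ c → cellValue b c ≡ cellValue b′ c) →
  (P : Skeleton n (operations n)) (outs : Vec (Wire n (operations n)) n) →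
  restriction b P outs ↭ restriction b′ P outs
restriction-↭ b b′ eq P outs = multiplicity-≡⇒↭ _ _
  (subsetSum-exponents b _ (Bounded-term P outs))
  (subsetSum-exponents b′ _ (Bounded-term P outs))
  λ μ μ≤D → let ν , ν≡μ = ExponentsAtMost⇒Fin μ≤D in
    subst (λ μ → multiplicity μ (restriction b P outs) ≡ multiplicity μ (restriction b′ P outs))
          ν≡μ (eq ((P , outs) , ν))

theorem1p2 : {c ℓ : Level} →
    Σ ℕ λ n₀ → (n : ℕ) → n₀ ≤ n →
    (F : Field c ℓ) → CardAtLeast F (n * n) →
    Σ (Poly F n) λ Q →
    NonZero F Q × DegreeAtMost F Q (n ^ 3) ×
    ((C : Circuit F n) → 200 * size F C ≤ n * n →
    (A : Matrix F n) → Computes F C A → Field._≈_ F (eval F Q A) (Field.0# F))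
theorem1p2 = 10 , λ n 10≤n F _ →
  let open Field F using (_-_; +-congʳ; -‿inverseʳ) renaming (trans to ≈-trans)
      b , b′ , (x , bx≢b′x) , eq =
        siegel (Cell-↪-Fin n) (fewer-values-than-subsets 10≤n) cellValue cellValue-<
  in difference F b b′ (exponent n)
   -- The nonzero coefficient sits at an index where the two selections differ.
   , (exponent n x , λ coeff≈0 → indicator-≢ F bx≢b′x
       (≈-trans
         (Field.sym F (coeff-tabulate F (λ y → indicator F (b y) - indicator F (b′ y))
           (exponent n) (exponent-injective n) x))
         coeff≈0))
   , (λ t∈Q → let y , t≡ = ∈-tabulate⁻ t∈Q in
       subst (λ e → monoDeg F e ≤ n ^ 3) (sym (cong proj₂ t≡))
         (subst (monoDeg F (exponent n y) ≤_) (cong (λ z → n * (n * z)) (sym (*-identityʳ n)))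
           (monoDeg-exponent F n y)))
   , λ C 200size≤n² A computes →
       -- Division by 200 is monotone and exact on `200 * size F C`, so the rounding in
       -- `operations n` loses nothing.
       let size≤ = subst (_≤ operations n)
             (trans (cong (_/ 200) (*-comm 200 (size F C))) (m*n/n≡m (size F C) 200))
             (/-monoˡ-≤ 200 200size≤n²)
           P , outs , α , A≈ = computed-by-skeleton F C A size≤ computes
       in ≈-trans (eval-difference F α (outputPoly P outs) A A≈ b b′ (exponent n))
            -- The two restrictions are permutations of each other, so the value has the form x - x.
            (≈-trans (+-congʳ (evalℕ-↭ F α (restriction-↭ b b′ eq P outs)))
                     (-‿inverseʳ _))
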